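{- Let $M=(E,\mathcal{I})$ be a finite matroid and let $x,y\in E$ be distinct. In the matroid independent set toggle group $T(\mathcal{I})$, $(t_xt_y)^2=1$ if and only if no circuit of $M$ contains both $x$ and $y$.
   Context: $\mathcal{I}\subseteq 2^E$ is the set of independent sets of the matroid $M$ on the finite ground set $E$; a circuit is a minimal dependent (non-independent) subset of $E$. For $x\in E$ the toggle $t_x:\mathcal{I}\to\mathcal{I}$ is given by $t_x(X)=X\cup\{x\}$ if $x\notin X$ and $X\cup\{x\}\in\mathcal{I}$; $t_x(X)=X\setminus\{x\}$ if $x\in X$ and $X\setminus\{x\}\in\mathcal{I}$; and $t_x(X)=X$ otherwise. $T(\mathcal{I})$ is the subgroup of the symmetric group on $\mathcal{I}$ generated by all $t_x$, $x\in E$. -}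

module Defs where

open import Algebra.Bundles using (Group; RawGroup)
open import Algebra.Structures using (IsGroup)
import Algebra.Definitions.RawMonoid as RawMonoid
import Algebra.Morphism.GroupMonomorphism as GroupMonomorphism
open import Data.Fin.Base using (Fin; zero; suc)
open import Data.Fin.Subset
open import Data.Fin.Subset.Properties
open import Data.Irrelevant using ([_])
open import Data.Nat.Base using (ℕ; _<_)
open import Data.Product.Base using (∃; _×_; _,_; proj₁)
open import Data.Refinement using (Refinement; value; value-injective; _,_)
open import Data.Sum.Base using (inj₁; inj₂)
open import Data.Vec.Base using (_∷_; there)
open import Function.Base using (id)
open import Function.Bundles using (_↔_; mk↔ₛ′; Inverse)
open import Function.Construct.Composition using (_↔-∘_)
open import Function.Construct.Identity using (↔-id)
open import Function.Construct.Symmetry using (↔-sym)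
open import Level using (Level; _⊔_) renaming (suc to lsuc)
open import Relation.Binary.PropositionalEquality
open import Relation.Nullary using (¬_; Dec; yes; no; contradiction; recompute)
open import Relation.Unary using (Decidable)

------------------------------------------------------------------------
-- Groups

-- Composition is in the usual order: (f ∙ g) x = f (g x).
Sym : ∀ {a} → Set a → Group a a
Sym A = record
  { Carrier = A ↔ A
  ; _≈_     = λ f g → to f ≗ to g
  ; _∙_     = _↔-∘_
  ; ε       = ↔-id A
  ; _⁻¹     = ↔-sym
  ; isGroup = record
    { isMonoid = record
      { isSemigroup = record
        { isMagma = record
          { isEquivalence = record
            { refl  = λ _ → refl
            ; sym   = λ p x → sym (p x)
            ; trans = λ p q x → trans (p x) (q x)
            }
          ; ∙-cong = λ {f} {g} {h} {k} p q x →
              trans (cong (to f) (q x)) (p (to k x))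
          }
        ; assoc = λ _ _ _ _ → refl
        }
      ; identity = (λ _ _ → refl) , (λ _ _ → refl)
      }
    ; inverse = strictlyInverseʳ , strictlyInverseˡ
    ; ⁻¹-cong = λ {f} {g} p x → begin
        from f x                   ≡⟨ cong (from f) (strictlyInverseˡ g x) ⟨
        from f (to g (from g x))   ≡⟨ cong (from f) (p (from g x)) ⟨
        from f (to f (from g x))   ≡⟨ strictlyInverseʳ f (from g x) ⟩
        from g x                   ∎
    }
  }
  where
  open Inverse
  open ≡-Reasoning

module GeneratedSubgroup {c ℓ i} (G : Group c ℓ) {I : Set i}
                         (g : I → Group.Carrier G) where
  open Group G using (Carrier; _≈_; _∙_; ε; _⁻¹)

  data Generated : Carrier → Set (c ⊔ ℓ ⊔ i) where
    gen    : ∀ j → Generated (g j)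
    unit   : Generated ε
    mul    : ∀ {a b} → Generated a → Generated b → Generated (a ∙ b)
    inv    : ∀ {a} → Generated a → Generated (a ⁻¹)
    resp-≈ : ∀ {a b} → a ≈ b → Generated a → Generated b

  rawSubgroup : RawGroup (c ⊔ ℓ ⊔ i) ℓ
  rawSubgroup = record
    { Carrier = ∃ Generated
    ; _≈_     = λ a b → proj₁ a ≈ proj₁ b
    ; _∙_     = λ (a , p) (b , q) → a ∙ b , mul p q
    ; ε       = ε , unit
    ; _⁻¹     = λ (a , p) → a ⁻¹ , inv p
    }

  isGroup : IsGroup (RawGroup._≈_ rawSubgroup) (RawGroup._∙_ rawSubgroup)
                    (RawGroup.ε rawSubgroup) (RawGroup._⁻¹ rawSubgroup)
  isGroup = GroupMonomorphism.isGroup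
    {G₁ = rawSubgroup} {G₂ = Group.rawGroup G} {⟦_⟧ = proj₁}
    (record
      { isGroupHomomorphism = record
        { isMonoidHomomorphism = record
          { isMagmaHomomorphism = record
            { isRelHomomorphism = record { cong = id }
            ; homo = λ _ _ → Group.refl G
            }
          ; ε-homo = Group.refl G
          }
        ; ⁻¹-homo = λ _ → Group.refl G
        }
      ; injective = id
      })
    (Group.isGroup G)

  subgroup : Group (c ⊔ ℓ ⊔ i) ℓ
  subgroup = record { isGroup = isGroup }

  generator : I → Group.Carrier subgroup
  generator j = g j , gen j

module Power {c ℓ} (G : Group c ℓ) where
  open Group G using (Carrier; rawMonoid)
  open RawMonoid rawMonoid using () renaming (_×_ to _·_)

  infixr 8 _^_

  -- The library writes the k-th power additively, as a k-fold multiple.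
  _^_ : Carrier → ℕ → Carrier
  g ^ k = k · g

------------------------------------------------------------------------
-- Matroids

-- The ground set is Fin n.  Decidability of independence holds for every
-- matroid classically; constructively it is what makes toggles computable.
record Matroid (n : ℕ) (ℓ : Level) : Set (lsuc ℓ) where
  field
    Independent  : Subset n → Set ℓ
    independent? : Decidable Independent
    ⊥-indep      : Independent ⊥
    ⊆-indep      : ∀ {X Y} → X ⊆ Y → Independent Y → Independent X
    exchange     : ∀ {X Y} → Independent X → Independent Y → ∣ X ∣ < ∣ Y ∣ →
                   ∃ λ e → e ∈ Y × e ∉ X × Independent (X ∪ ⁅ e ⁆)

  Dependent : Subset n → Set ℓ
  Dependent X = ¬ Independent X

  Circuit : Subset n → Set ℓ
  Circuit C = Dependent C × (∀ {D} → D ⊂ C → ¬ Dependent D)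

  -- Independence proofs are irrelevant, so that _≡_ on 𝓘 is equality of the
  -- underlying subsets.
  𝓘 : Set ℓ
  𝓘 = Refinement (Subset n) Independent

------------------------------------------------------------------------
-- Toggles

private
  x∉X-x : ∀ {n} (x : Fin n) X → x ∉ X - x
  x∉X-x zero    (_ ∷ _) ()
  x∉X-x (suc x) (_ ∷ X) (there x∈) = x∉X-x x X x∈

  add-remove : ∀ {n} (x : Fin n) X → x ∉ X → (X ∪ ⁅ x ⁆) - x ≡ X
  add-remove x X x∉X = ⊆-antisym ⊆₁ ⊆₂
    where
    ⊆₁ : (X ∪ ⁅ x ⁆) - x ⊆ X
    ⊆₁ z∈ with x∈p∪q⁻ X ⁅ x ⁆ (p─q⊆p (X ∪ ⁅ x ⁆) ⁅ x ⁆ z∈)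
    ... | inj₁ z∈X = z∈X
    ... | inj₂ z∈x with x∈⁅y⁆⇒x≡y x z∈x
    ...   | refl = contradiction z∈ (x∉X-x x (X ∪ ⁅ x ⁆))

    ⊆₂ : X ⊆ (X ∪ ⁅ x ⁆) - x
    ⊆₂ z∈X = x∈p∧x≢y⇒x∈p-y (p⊆p∪q ⁅ x ⁆ z∈X) λ where refl → x∉X z∈X

  remove-add : ∀ {n} (x : Fin n) X → x ∈ X → (X - x) ∪ ⁅ x ⁆ ≡ X
  remove-add x X x∈X = ⊆-antisym ⊆₁ ⊆₂
    where
    ⊆₁ : (X - x) ∪ ⁅ x ⁆ ⊆ X
    ⊆₁ z∈ with x∈p∪q⁻ (X - x) ⁅ x ⁆ z∈
    ... | inj₁ z∈X-x = p─q⊆p X ⁅ x ⁆ z∈X-x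
    ... | inj₂ z∈x with x∈⁅y⁆⇒x≡y x z∈x
    ...   | refl = x∈X

    ⊆₂ : X ⊆ (X - x) ∪ ⁅ x ⁆
    ⊆₂ {z} z∈X with z ∈? ⁅ x ⁆
    ... | yes z∈x = x∈p∪q⁺ (inj₂ z∈x)
    ... | no  z∉x = x∈p∪q⁺ (inj₁ (x∈p∧x≢y⇒x∈p-y z∈X (x∉⁅y⁆⇒x≢y z∉x)))

module Toggle {n ℓ} (M : Matroid n ℓ) where
  open Matroid M

  toggle : Fin n → 𝓘 → 𝓘
  toggle x (X , p) with x ∈? X | independent? (X ∪ ⁅ x ⁆) | independent? (X - x)
  ... | no  _ | yes q | _     = X ∪ ⁅ x ⁆ , [ q ]
  ... | yes _ | _     | yes q = X - x , [ q ]
  ... | no  _ | no  _ | _     = X , p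
  ... | yes _ | _     | no  _ = X , p

  private
    toggle-∉ : ∀ x (S : 𝓘) → x ∉ value S → Independent (value S ∪ ⁅ x ⁆) →
               value (toggle x S) ≡ value S ∪ ⁅ x ⁆
    toggle-∉ x (X , p) x∉X q
      with x ∈? X | independent? (X ∪ ⁅ x ⁆) | independent? (X - x)
    ... | no  _   | yes _ | _ = refl
    ... | no  _   | no ¬q | _ = contradiction q ¬q
    ... | yes x∈X | _     | _ = contradiction x∈X x∉X

    toggle-∈ : ∀ x (S : 𝓘) → x ∈ value S → Independent (value S - x) →
               value (toggle x S) ≡ value S - x
    toggle-∈ x (X , p) x∈X q
      with x ∈? X | independent? (X ∪ ⁅ x ⁆) | independent? (X - x)
    ... | yes _  | _ | yes _ = refl
    ... | yes _  | _ | no ¬q = contradiction q ¬q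
    ... | no x∉X | _ | _     = contradiction x∈X x∉X

    toggle-∉-fixed : ∀ x (S : 𝓘) → x ∉ value S → Dependent (value S ∪ ⁅ x ⁆) →
                     toggle x S ≡ S
    toggle-∉-fixed x (X , p) x∉X ¬q
      with x ∈? X | independent? (X ∪ ⁅ x ⁆) | independent? (X - x)
    ... | no  _   | yes q | _ = contradiction q ¬q
    ... | no  _   | no  _ | _ = refl
    ... | yes x∈X | _     | _ = contradiction x∈X x∉X

    independent : (S : 𝓘) → Independent (value S)
    independent (X , [ p ]) = recompute (independent? X) p

  toggle-involutive : ∀ x S → toggle x (toggle x S) ≡ S
  toggle-involutive x S = by-cases (x ∈? X) (independent? (X ∪ ⁅ x ⁆))
    where
    X = value S

    by-cases : Dec (x ∈ X) → Dec (Independent (X ∪ ⁅ x ⁆)) →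
               toggle x (toggle x S) ≡ S
    by-cases (no x∉X) (no ¬q) = trans (cong (toggle x) fixed) fixed
      where fixed = toggle-∉-fixed x S x∉X ¬q
    by-cases (no x∉X) (yes q) = value-injective (begin
      value (toggle x (toggle x S)) ≡⟨ toggle-∈ x (toggle x S) x∈tX indep ⟩
      value (toggle x S) - x        ≡⟨ cong (_- x) tX≡ ⟩
      (X ∪ ⁅ x ⁆) - x               ≡⟨ add-remove x X x∉X ⟩
      X                             ∎)
      where
      open ≡-Reasoning
      tX≡   = toggle-∉ x S x∉X q
      x∈tX  = subst (x ∈_) (sym tX≡) (q⊆p∪q X ⁅ x ⁆ (x∈⁅x⁆ x))
      indep = ⊆-indep (p─q⊆p _ ⁅ x ⁆) (independent (toggle x S))
    by-cases (yes x∈X) _ = value-injective (begin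
      value (toggle x (toggle x S)) ≡⟨ toggle-∉ x (toggle x S) x∉tX indep ⟩
      value (toggle x S) ∪ ⁅ x ⁆    ≡⟨ tX∪x≡X ⟩
      X                             ∎)
      where
      open ≡-Reasoning
      tX≡    = toggle-∈ x S x∈X (⊆-indep (p─q⊆p X ⁅ x ⁆) (independent S))
      x∉tX   = subst (x ∉_) (sym tX≡) (x∉X-x x X)
      tX∪x≡X = trans (cong (_∪ ⁅ x ⁆) tX≡) (remove-add x X x∈X)
      indep  = subst Independent (sym tX∪x≡X) (independent S)

  toggle↔ : Fin n → 𝓘 ↔ 𝓘
  toggle↔ x = mk↔ₛ′ (toggle x) (toggle x) (toggle-involutive x) (toggle-involutive x)

  open GeneratedSubgroup (Sym 𝓘) toggle↔

  toggleGroup : Group ℓ ℓ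
  toggleGroup = subgroup

  t : Fin n → Group.Carrier toggleGroup
  t = generator

{-# OPTIONS --safe #-}
-- Since toggles are involutions, (t_x t_y)² = 1 says that t_x and t_y commute,
-- and it suffices to test this on independent sets X avoiding x and y.  There
-- both toggles act by insertion, and they can only interfere when X ∪ {x} and
-- X ∪ {y} are independent but X ∪ {x, y} is not; then every circuit inside
-- X ∪ {x, y} contains both x and y.  Conversely, if x, y ∈ C for a circuit C,
-- then t_x fixes C \ {x} but moves t_y (C \ {x}) = C \ {x, y}.
module Submission where

open import Defs
open import Algebra.Bundles using (Group)
open import Data.Fin.Base using (Fin; zero; suc)
open import Data.Fin.Subset using (Subset; _∈_; _∉_; _⊆_; _⊂_; _∪_; _-_; ⁅_⁆)
open import Data.Fin.Subset.Induction using (⊂-wellFounded)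
open import Data.Fin.Subset.Properties
open import Data.Irrelevant using ([_])
open import Data.Nat.Base using (ℕ)
open import Data.Product.Base using (∃; _×_; _,_)
open import Data.Refinement using (value; value-injective; _,_)
open import Data.Sum.Base using (inj₁; inj₂)
open import Data.Vec.Base using (_∷_; there)
open import Function.Base using (_∘_)
open import Function.Bundles using (_⇔_; mk⇔)
open import Induction.WellFounded using (Acc; acc)
open import Level using (Level)
open import Relation.Binary.PropositionalEquality
open import Relation.Nullary using (¬_; Dec; yes; no; contradiction; recompute; _×-dec_; ¬?)
open import Relation.Nullary.Decidable using (decidable-stable)

private
  variable
    n : ℕ
    p q : Subset n
    x y : Fin n

-- Inserting and deleting a single element of a subset.

x∉p-x : ∀ (x : Fin n) p → x ∉ p - x
x∉p-x zero    (_ ∷ _) ()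
x∉p-x (suc x) (_ ∷ p) (there x∈) = x∉p-x x p x∈

p-x⊆p : ∀ (p : Subset n) x → p - x ⊆ p
p-x⊆p p x = p─q⊆p p ⁅ x ⁆

x∈p∪⁅x⁆ : ∀ (p : Subset n) x → x ∈ p ∪ ⁅ x ⁆
x∈p∪⁅x⁆ p x = q⊆p∪q p ⁅ x ⁆ (x∈⁅x⁆ x)

p⊆q∧x∈q⇒p∪⁅x⁆⊆q : p ⊆ q → x ∈ q → p ∪ ⁅ x ⁆ ⊆ q
p⊆q∧x∈q⇒p∪⁅x⁆⊆q {p = p} {x = x} p⊆q x∈q z∈ with x∈p∪q⁻ p ⁅ x ⁆ z∈
... | inj₁ z∈p = p⊆q z∈p
... | inj₂ z∈x with refl ← x∈⁅y⁆⇒x≡y x z∈x = x∈q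

p⊆q∪⁅x⁆∧x∉p⇒p⊆q : p ⊆ q ∪ ⁅ x ⁆ → x ∉ p → p ⊆ q
p⊆q∪⁅x⁆∧x∉p⇒p⊆q {q = q} {x = x} p⊆q∪x x∉p z∈p with x∈p∪q⁻ q ⁅ x ⁆ (p⊆q∪x z∈p)
... | inj₁ z∈q = z∈q
... | inj₂ z∈x with refl ← x∈⁅y⁆⇒x≡y x z∈x = contradiction z∈p x∉p

p⊆[p-x]∪⁅x⁆ : ∀ (p : Subset n) x → p ⊆ (p - x) ∪ ⁅ x ⁆
p⊆[p-x]∪⁅x⁆ p x {z} z∈p with z ∈? ⁅ x ⁆
... | yes z∈x = q⊆p∪q (p - x) ⁅ x ⁆ z∈x
... | no  z∉x = p⊆p∪q ⁅ x ⁆ (x∈p∧x≢y⇒x∈p-y z∈p (x∉⁅y⁆⇒x≢y z∉x))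

∪-⁅⁆-swap : ∀ (p : Subset n) x y → (p ∪ ⁅ x ⁆) ∪ ⁅ y ⁆ ≡ (p ∪ ⁅ y ⁆) ∪ ⁅ x ⁆
∪-⁅⁆-swap p x y = begin
  (p ∪ ⁅ x ⁆) ∪ ⁅ y ⁆  ≡⟨ ∪-assoc p ⁅ x ⁆ ⁅ y ⁆ ⟩
  p ∪ (⁅ x ⁆ ∪ ⁅ y ⁆)  ≡⟨ cong (p ∪_) (∪-comm ⁅ x ⁆ ⁅ y ⁆) ⟩
  p ∪ (⁅ y ⁆ ∪ ⁅ x ⁆)  ≡⟨ ∪-assoc p ⁅ y ⁆ ⁅ x ⁆ ⟨
  (p ∪ ⁅ y ⁆) ∪ ⁅ x ⁆  ∎
  where open ≡-Reasoning

module _ {ℓ} (M : Matroid n ℓ) where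
  open Matroid M
  open Toggle M

  -- Descent along `_⊂_`: an exhaustive search looks for a dependent proper subset. If there is
  -- none, `D` is itself minimal; otherwise the descent continues inside the subset found.
  dependent⇒⊇circuit : ∀ {D} → Dependent D → ∃ λ C → Circuit C × C ⊆ D
  dependent⇒⊇circuit {D} = go (⊂-wellFounded D)
    where
    go : ∀ {D} → Acc _⊂_ D → Dependent D → ∃ λ C → Circuit C × C ⊆ D
    go {D} (acc rs) D-dep with anySubset? (λ E → (E ⊂? D) ×-dec ¬? (independent? E))
    ... | no ¬∃ = D , (D-dep , λ E⊂D E-dep → ¬∃ (_ , E⊂D , E-dep)) , ⊆-refl
    ... | yes (E , E⊂D@(E⊆D , _) , E-dep) with go (rs E⊂D) E-dep
    ...   | C , C-circ , C⊆E = C , C-circ , E⊆D ∘ C⊆E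

  -- The effect of one toggle on an independent set.

  value-independent : (S : 𝓘) → Independent (value S)
  -- The proof stored in `S` is irrelevant; decidability rebuilds a usable one.
  value-independent (X , [ p ]) = recompute (independent? X) p

  toggle-insert : ∀ {x} S → x ∉ value S → Independent (value S ∪ ⁅ x ⁆) →
                  value (toggle x S) ≡ value S ∪ ⁅ x ⁆
  toggle-insert {x} (X , _) x∉X q
    with x ∈? X | independent? (X ∪ ⁅ x ⁆) | independent? (X - x)
  ... | no  _   | yes _ | _ = refl
  ... | no  _   | no ¬q | _ = contradiction q ¬q
  ... | yes x∈X | _     | _ = contradiction x∈X x∉X

  toggle-stuck : ∀ {x} S → x ∉ value S → Dependent (value S ∪ ⁅ x ⁆) → toggle x S ≡ S
  toggle-stuck {x} (X , _) x∉X ¬q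
    with x ∈? X | independent? (X ∪ ⁅ x ⁆) | independent? (X - x)
  ... | no  _   | yes q | _ = contradiction q ¬q
  ... | no  _   | no  _ | _ = refl
  ... | yes x∈X | _     | _ = contradiction x∈X x∉X

  -- Deletion never gets stuck, because subsets of independent sets are independent.
  toggle-remove : ∀ {x} S → x ∈ value S → value (toggle x S) ≡ value S - x
  toggle-remove {x} S@(X , _) x∈X
    with x ∈? X | independent? (X ∪ ⁅ x ⁆) | independent? (X - x)
  ... | yes _  | _ | yes _ = refl
  ... | yes _  | _ | no ¬q = contradiction (⊆-indep (p-x⊆p X x) (value-independent S)) ¬q
  ... | no x∉X | _ | _     = contradiction x∈X x∉X

  ∉⇒⊆toggle : ∀ {x} S → x ∉ value S → value S ⊆ value (toggle x S)
  ∉⇒⊆toggle {x} S x∉S = by-cases (independent? (value S ∪ ⁅ x ⁆))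
    where
    by-cases : Dec (Independent (value S ∪ ⁅ x ⁆)) → value S ⊆ value (toggle x S)
    by-cases (yes q) = ⊆-trans (p⊆p∪q ⁅ x ⁆) (⊆-reflexive (sym (toggle-insert S x∉S q)))
    by-cases (no ¬q) = ⊆-reflexive (cong value (sym (toggle-stuck S x∉S ¬q)))

  toggle⊆∪ : ∀ x S → value (toggle x S) ⊆ value S ∪ ⁅ x ⁆
  toggle⊆∪ x S = by-cases (x ∈? value S) (independent? (value S ∪ ⁅ x ⁆))
    where
    by-cases : Dec (x ∈ value S) → Dec (Independent (value S ∪ ⁅ x ⁆)) →
               value (toggle x S) ⊆ value S ∪ ⁅ x ⁆
    by-cases (yes x∈S) _       = ⊆-trans (⊆-reflexive (toggle-remove S x∈S))
                                   (⊆-trans (p-x⊆p (value S) x) (p⊆p∪q ⁅ x ⁆))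
    by-cases (no  x∉S) (yes q) = ⊆-reflexive (toggle-insert S x∉S q)
    by-cases (no  x∉S) (no ¬q) = ⊆-trans (⊆-reflexive (cong value (toggle-stuck S x∉S ¬q)))
                                   (p⊆p∪q ⁅ x ⁆)

  toggle-∉ : x ≢ y → ∀ S → x ∉ value S → x ∉ value (toggle y S)
  toggle-∉ {y = y} x≢y S x∉S x∈ with x∈p∪q⁻ (value S) ⁅ y ⁆ (toggle⊆∪ y S x∈)
  ... | inj₁ x∈S = x∉S x∈S
  ... | inj₂ x∈y = x≢y (x∈⁅y⁆⇒x≡y y x∈y)

  -- Commutation of two toggles, one independent set at a time.

  CommuteAt : Fin n → Fin n → 𝓘 → Set ℓ
  CommuteAt x y S = toggle x (toggle y S) ≡ toggle y (toggle x S)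

  square≡id⇒commute : ∀ {S} → toggle x (toggle y (toggle x (toggle y S))) ≡ S → CommuteAt x y S
  square≡id⇒commute {x} {y} {S} eq = begin
    toggle x (toggle y S)
      ≡⟨ toggle-involutive y _ ⟨
    toggle y (toggle y (toggle x (toggle y S)))
      ≡⟨ cong (toggle y) (toggle-involutive x _) ⟨
    toggle y (toggle x (toggle x (toggle y (toggle x (toggle y S)))))
      ≡⟨ cong (toggle y ∘ toggle x) eq ⟩
    toggle y (toggle x S)
      ∎
    where open ≡-Reasoning

  commute⇒square≡id : ∀ {S} → CommuteAt x y S → toggle x (toggle y (toggle x (toggle y S))) ≡ S
  commute⇒square≡id {x} {y} {S} eq = begin
    toggle x (toggle y (toggle x (toggle y S))) ≡⟨ cong (toggle x ∘ toggle y) eq ⟩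
    toggle x (toggle y (toggle y (toggle x S))) ≡⟨ cong (toggle x) (toggle-involutive y _) ⟩
    toggle x (toggle x S)                       ≡⟨ toggle-involutive x S ⟩
    S                                           ∎
    where open ≡-Reasoning

  -- Apply `toggle x` to both sides and cancel the involutions. This carries commutation back from a
  -- set with `x` toggled out to the original set.
  commute-toggle⁻ : ∀ {S} → CommuteAt x y (toggle x S) → CommuteAt x y S
  commute-toggle⁻ {x} {y} {S} eq = begin
    toggle x (toggle y S)                       ≡⟨ cong (toggle x ∘ toggle y) (toggle-involutive x S) ⟨
    toggle x (toggle y (toggle x (toggle x S))) ≡⟨ cong (toggle x) eq ⟨
    toggle x (toggle x (toggle y (toggle x S))) ≡⟨ toggle-involutive x _ ⟩
    toggle y (toggle x S)                       ∎
    where open ≡-Reasoning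

  -- Toggle out `y` if present, then `x`. The second toggle cannot bring `y` back, since `x` and `y`
  -- are distinct.
  commute-avoiding⇒commute : x ≢ y →
    (∀ S → x ∉ value S → y ∉ value S → CommuteAt x y S) → ∀ S → CommuteAt x y S
  commute-avoiding⇒commute {x} {y} x≢y base S = from-avoiding-y (y ∈? value S)
    where
    avoids : ∀ {z S} → z ∈ value S → z ∉ value (toggle z S)
    avoids {z} {S} z∈S = subst (z ∉_) (sym (toggle-remove S z∈S)) (x∉p-x z (value S))

    from-avoiding-x : ∀ S → y ∉ value S → Dec (x ∈ value S) → CommuteAt x y S
    from-avoiding-x S y∉S (no  x∉S) = base S x∉S y∉S
    from-avoiding-x S y∉S (yes x∈S) =
      commute-toggle⁻ (base (toggle x S) (avoids x∈S) (toggle-∉ (≢-sym x≢y) S y∉S))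

    from-avoiding-y : Dec (y ∈ value S) → CommuteAt x y S
    from-avoiding-y (no  y∉S) = from-avoiding-x S y∉S (x ∈? _)
    from-avoiding-y (yes y∈S) =
      -- Here `y` is the element toggled out, so the roles of `x` and `y` are exchanged on the way
      -- in and back.
      sym (commute-toggle⁻ (sym (from-avoiding-x (toggle y S) (avoids y∈S) (x ∈? _))))

  -- As `y` is not in `S`, toggling `y` can only enlarge `S`, so adding `x` stays dependent. Thus
  -- `toggle x` is stuck both before and after `toggle y`.
  dependent⇒commute : x ≢ y → ∀ S → x ∉ value S → y ∉ value S →
                      Dependent (value S ∪ ⁅ x ⁆) → CommuteAt x y S
  dependent⇒commute {x} {y} x≢y S x∉S y∉S dep = begin
    toggle x (toggle y S) ≡⟨ toggle-stuck (toggle y S) (toggle-∉ x≢y S x∉S) dep′ ⟩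
    toggle y S            ≡⟨ cong (toggle y) (toggle-stuck S x∉S dep) ⟨
    toggle y (toggle x S) ∎
    where
    open ≡-Reasoning
    dep′ : Dependent (value (toggle y S) ∪ ⁅ x ⁆)
    dep′ = dep ∘ ⊆-indep (p⊆q∧x∈q⇒p∪⁅x⁆⊆q
      (p⊆p∪q ⁅ x ⁆ ∘ ∉⇒⊆toggle S y∉S) (x∈p∪⁅x⁆ (value (toggle y S)) x))

  toggle-insert₂ : x ≢ y → ∀ S → x ∉ value S → y ∉ value S →
                   Independent (value S ∪ ⁅ y ⁆) → Independent ((value S ∪ ⁅ y ⁆) ∪ ⁅ x ⁆) →
                   value (toggle x (toggle y S)) ≡ (value S ∪ ⁅ y ⁆) ∪ ⁅ x ⁆
  toggle-insert₂ {x} {y} x≢y S x∉S y∉S y-indep yx-indep = begin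
    value (toggle x (toggle y S))   ≡⟨ toggle-insert (toggle y S) (toggle-∉ x≢y S x∉S)
                                         (subst (Independent ∘ (_∪ ⁅ x ⁆)) (sym ty≡) yx-indep) ⟩
    value (toggle y S) ∪ ⁅ x ⁆      ≡⟨ cong (_∪ ⁅ x ⁆) ty≡ ⟩
    (value S ∪ ⁅ y ⁆) ∪ ⁅ x ⁆       ∎
    where
    open ≡-Reasoning
    ty≡ = toggle-insert S y∉S y-indep

  CircuitThrough : Fin n → Fin n → Set ℓ
  CircuitThrough x y = ∃ λ C → Circuit C × x ∈ C × y ∈ C

  -- A circuit inside `X` with both elements added cannot omit either one: it would then lie in one
  -- of the two sets assumed independent.
  no-circuit⇒∪-independent : ∀ {X} → ¬ CircuitThrough x y →
    Independent (X ∪ ⁅ x ⁆) → Independent (X ∪ ⁅ y ⁆) → Independent ((X ∪ ⁅ x ⁆) ∪ ⁅ y ⁆)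
  no-circuit⇒∪-independent {x} {y} {X} none x-indep y-indep =
    decidable-stable (independent? _) λ dep → none (through (dependent⇒⊇circuit dep))
    where
    through : ∃ (λ C → Circuit C × C ⊆ (X ∪ ⁅ x ⁆) ∪ ⁅ y ⁆) → CircuitThrough x y
    through (C , C-circ@(C-dep , _) , C⊆) = C , C-circ ,
      decidable-stable (x ∈? C) (λ x∉C → C-dep (⊆-indep
        (p⊆q∪⁅x⁆∧x∉p⇒p⊆q (subst (C ⊆_) (∪-⁅⁆-swap X x y) C⊆) x∉C) y-indep)) ,
      decidable-stable (y ∈? C) (λ y∉C → C-dep (⊆-indep
        (p⊆q∪⁅x⁆∧x∉p⇒p⊆q C⊆ y∉C) x-indep))

  no-circuit⇒commute : x ≢ y → ¬ CircuitThrough x y → ∀ S → CommuteAt x y S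
  no-circuit⇒commute {x} {y} x≢y none = commute-avoiding⇒commute x≢y base
    where
    base : ∀ S → x ∉ value S → y ∉ value S → CommuteAt x y S
    base S x∉S y∉S = by-cases (independent? (value S ∪ ⁅ x ⁆)) (independent? (value S ∪ ⁅ y ⁆))
      where
      by-cases : Dec (Independent (value S ∪ ⁅ x ⁆)) → Dec (Independent (value S ∪ ⁅ y ⁆)) →
                 CommuteAt x y S
      by-cases (no x-dep)    _             = dependent⇒commute x≢y S x∉S y∉S x-dep
      by-cases (yes _)       (no y-dep)    = sym (dependent⇒commute (≢-sym x≢y) S y∉S x∉S y-dep)
      -- Only this case uses the absence of circuits: it lets the second insertion succeed in either
      -- order.
      by-cases (yes x-indep) (yes y-indep) = value-injective (begin
        value (toggle x (toggle y S))  ≡⟨ toggle-insert₂ x≢y S x∉S y∉S y-indep yx-indep ⟩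
        (value S ∪ ⁅ y ⁆) ∪ ⁅ x ⁆      ≡⟨ ∪-⁅⁆-swap (value S) y x ⟩
        (value S ∪ ⁅ x ⁆) ∪ ⁅ y ⁆      ≡⟨ toggle-insert₂ (≢-sym x≢y) S y∉S x∉S x-indep xy-indep ⟨
        value (toggle y (toggle x S))  ∎)
        where
        open ≡-Reasoning
        xy-indep = no-circuit⇒∪-independent none x-indep y-indep
        yx-indep = subst Independent (∪-⁅⁆-swap (value S) x y) xy-indep

  -- The contradiction concerns membership of `x` at `U`, which is `C` without `x`: toggling `y` and
  -- then `x` inserts `x`, while in the other order `x` never enters.
  commute⇒no-circuit : x ≢ y → (∀ S → CommuteAt x y S) → ¬ CircuitThrough x y
  commute⇒no-circuit {x} {y} x≢y commute (C , (C-dep , C-min) , x∈C , y∈C) =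
    x∉tyU (subst (x ∈_) txtyU≡tyU x∈txtyU)
    where
    delete-indep : ∀ {z} → z ∈ C → Independent (C - z)
    delete-indep z∈C = decidable-stable (independent? _) (C-min (x∈p⇒p-x⊂p z∈C))

    U : 𝓘
    U = C - x , [ delete-indep x∈C ]

    tyU≡ : value (toggle y U) ≡ C - x - y
    tyU≡ = toggle-remove U (x∈p∧x≢y⇒x∈p-y y∈C (≢-sym x≢y))

    x∉tyU : x ∉ value (toggle y U)
    x∉tyU = toggle-∉ x≢y U (x∉p-x x C)

    -- With `y` gone, putting `x` back stays inside `C - y`, a proper subset of the circuit.
    tyU∪x-indep : Independent (value (toggle y U) ∪ ⁅ x ⁆)
    tyU∪x-indep = ⊆-indep
      (p⊆q∧x∈q⇒p∪⁅x⁆⊆q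
        (subst (_⊆ C - y) (trans (p─x─y≡p─y─x C y x) (sym tyU≡)) (p-x⊆p (C - y) x))
        (x∈p∧x≢y⇒x∈p-y x∈C x≢y))
      (delete-indep y∈C)

    x∈txtyU : x ∈ value (toggle x (toggle y U))
    x∈txtyU = subst (x ∈_) (sym (toggle-insert (toggle y U) x∉tyU tyU∪x-indep))
      (x∈p∪⁅x⁆ (value (toggle y U)) x)

    txU≡U : toggle x U ≡ U
    txU≡U = toggle-stuck U (x∉p-x x C) (C-dep ∘ ⊆-indep (p⊆[p-x]∪⁅x⁆ C x))

    txtyU≡tyU : value (toggle x (toggle y U)) ≡ value (toggle y U)
    txtyU≡tyU = cong value (trans (commute U) (cong (toggle y) txU≡U))

lemma3p36 : ∀ {ℓ : Level} {n : ℕ} (M : Matroid n ℓ) →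
    let open Matroid M
        open Toggle M
        open Group toggleGroup
        open Power toggleGroup
    in (x y : Fin n) → x ≢ y →
       ((t x ∙ t y) ^ 2 ≈ ε) ⇔ (¬ (∃ λ C → Circuit C × x ∈ C × y ∈ C))
lemma3p36 M x y x≢y = mk⇔
  -- Equality in the group is pointwise, and the square applied to `S` computes to four nested
  -- toggles.
  (λ squared → commute⇒no-circuit M x≢y λ S → square≡id⇒commute M (squared S))
  (λ none S → commute⇒square≡id M (no-circuit⇒commute M x≢y none S))
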